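{- If the field $\langle L,+,\times\rangle$ is an extension of finite degree of the field $\langle\mathbb{Q},+,\times\rangle$, then computability is stable over $\langle L,+,\times\rangle$.
   Context: Computability over natural numbers is the usual one. A set $A \subseteq \mathbb{N}$ is effectively enumerable if it is empty or the image of a total computable function from $\mathbb{N}$ to $\mathbb{N}$. For $A \subseteq \mathbb{N}^m$ and $B \subseteq \mathbb{N}$, a computable function from $A$ to $B$ is a partial computable function that is defined at every element of $A$ and takes values in $B$ there. Indexing: an indexing of a set $E$ is a partial function $i$ from $\mathbb{N}$ to $E$ such that $dom(i)$ is effectively enumerable, $i$ is surjective, and there is a computable function $eq$ from $dom(i)\times dom(i)$ to $\{0,1\}$ with $eq(x,y)=1$ if $i(x)=i(y)$ and $eq(x,y)=0$ otherwise. An indexing $i$ of the set $E$ is an admissible indexing of a one-sorted structure $\langle E,op_1,\ldots,op_p\rangle$ if every operation $op: E^m\to E$ among $op_1,\ldots,op_p$ is computable relatively to $i$, that is, there is a computable function $\hat{op}$ from $dom(i)^m$ to $dom(i)$ such that $i(\hat{op}(x_1,\ldots,x_m)) = op(i(x_1),\ldots,i(x_m))$ for all $x_1,\ldots,x_m\in dom(i)$. Computability is stable over $\langle E,op_1,\ldots,op_p\rangle$ if there exists an admissible indexing of this structure and, for all admissible indexings $j$ and $j'$ of it, there exists a computable function $h$ from $dom(j')$ to $dom(j)$ such that $j' = j\circ h$. -}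

module Defs where

open import Algebra.Bundles using (CommutativeRing)
import Algebra.Definitions
import Algebra.Definitions.RawMonoid
open import Algebra.Morphism.Structures using (module RingMorphisms)
open import Data.Fin.Base using (Fin)
open import Data.Nat.Base using (ℕ; zero; suc; _<_)
open import Data.Product.Base using (Σ; ∃; _×_; _,_; proj₁; proj₂)
import Data.Rational.Base as ℚ
import Data.Rational.Properties as ℚ
open import Data.Sum.Base using (_⊎_)
open import Data.Vec.Base using (Vec; []; _∷_; lookup)
open import Data.Vec.Relation.Binary.Pointwise.Inductive using (Pointwise; []; _∷_)
open import Data.Vec.Relation.Unary.All using (All; []; _∷_; reduce)
open import Function.Bundles using (_⇔_)
open import Level using (_⊔_; 0ℓ) renaming (suc to lsuc)
open import Relation.Binary.Bundles using (Setoid)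
open import Relation.Binary.PropositionalEquality.Core using (_≡_)
open import Relation.Nullary.Negation.Core using (¬_)
open import Relation.Unary using (Pred; Empty; U)

-- Codes for the μ-recursive partial functions, by arity.
data Program : ℕ → Set where
  zeroᵖ : ∀ {n} → Program n
  sucᵖ  : Program 1
  proj  : ∀ {n} → Fin n → Program n
  comp  : ∀ {m n} → Program m → Vec (Program n) m → Program n
  prec  : ∀ {n} → Program n → Program (suc (suc n)) → Program (suc n)
  μ     : ∀ {n} → Program (suc n) → Program n

infix 4 _⟨_⟩⇓_

-- f ⟨ xs ⟩⇓ y : the partial function f is defined at xs, with value y.
data _⟨_⟩⇓_ : ∀ {n} → Program n → Vec ℕ n → ℕ → Set where
  ⇓-zero : ∀ {n} {xs : Vec ℕ n} → zeroᵖ ⟨ xs ⟩⇓ 0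
  ⇓-suc  : ∀ {x} → sucᵖ ⟨ x ∷ [] ⟩⇓ suc x
  ⇓-proj : ∀ {n} {xs : Vec ℕ n} (k : Fin n) → proj k ⟨ xs ⟩⇓ lookup xs k
  ⇓-comp : ∀ {m n} {f : Program m} {gs : Vec (Program n) m} {xs ys z} →
           Pointwise (λ g y → g ⟨ xs ⟩⇓ y) gs ys → f ⟨ ys ⟩⇓ z →
           comp f gs ⟨ xs ⟩⇓ z
  ⇓-prec-zero : ∀ {n} {f : Program n} {g xs y} →
                f ⟨ xs ⟩⇓ y → prec f g ⟨ zero ∷ xs ⟩⇓ y
  ⇓-prec-suc  : ∀ {n} {f : Program n} {g k xs y z} →
                prec f g ⟨ k ∷ xs ⟩⇓ y → g ⟨ k ∷ y ∷ xs ⟩⇓ z →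
                prec f g ⟨ suc k ∷ xs ⟩⇓ z
  ⇓-μ : ∀ {n} {f : Program (suc n)} {xs y} →
        (∀ z → z < y → ∃ λ k → f ⟨ z ∷ xs ⟩⇓ suc k) → f ⟨ y ∷ xs ⟩⇓ 0 →
        μ f ⟨ xs ⟩⇓ y

-- A program may also be defined at points outside A, with arbitrary values there.
-- Below, a power A^m of A ⊆ ℕ is the predicate All A on Vec ℕ m.
record ComputableFunction {m} (A : Pred (Vec ℕ m) 0ℓ) (B : Pred ℕ 0ℓ) : Set where
  field
    program : Program m
    defined : ∀ {xs} → A xs → ∃ λ y → program ⟨ xs ⟩⇓ y × B y

  apply : ∀ {xs} → A xs → ℕ
  apply a = proj₁ (defined a)

  apply-∈ : ∀ {xs} (a : A xs) → B (apply a)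
  apply-∈ a = proj₂ (proj₂ (defined a))

open ComputableFunction public using (apply; apply-∈)

EffectivelyEnumerable : Pred ℕ 0ℓ → Set
EffectivelyEnumerable A =
  Empty A ⊎
  Σ (ComputableFunction {1} U U) λ f →
    ∀ y → A y ⇔ (∃ λ x → apply f {x ∷ []} _ ≡ y)

｛0,1｝ : Pred ℕ 0ℓ
｛0,1｝ y = y ≡ 0 ⊎ y ≡ 1

-- The set E is a setoid; a partial function ℕ ⇀ E is a domain together with a
-- value at each point of it that does not depend on the proof of membership.
record Indexing {c ℓ} (E : Setoid c ℓ) : Set (lsuc 0ℓ ⊔ c ⊔ ℓ) where
  open Setoid E
  field
    dom            : Pred ℕ 0ℓ
    index          : ∀ {x} → dom x → Carrier
    irrelevant     : ∀ {x} (p q : dom x) → index p ≈ index q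
    dom-enumerable : EffectivelyEnumerable dom
    surjective     : ∀ e → ∃ λ x → Σ (dom x) λ p → index p ≈ e
    eq             : ComputableFunction {2} (All dom) ｛0,1｝
    eq-1           : ∀ {x y} (p : dom x) (q : dom y) →
                     index p ≈ index q → apply eq (p ∷ q ∷ []) ≡ 1
    eq-0           : ∀ {x y} (p : dom x) (q : dom y) →
                     ¬ (index p ≈ index q) → apply eq (p ∷ q ∷ []) ≡ 0

record Structure c ℓ : Set (lsuc (c ⊔ ℓ)) where
  field
    setoid  : Setoid c ℓ
  open Setoid setoid public
  field
    #ops    : ℕ
    arity   : Fin #ops → ℕ
    op      : ∀ k → Vec Carrier (arity k) → Carrier
    op-cong : ∀ k {xs ys} → Pointwise _≈_ xs ys → op k xs ≈ op k ys

module _ {c ℓ} (S : Structure c ℓ) where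
  open Structure S

  IsAdmissible : Indexing setoid → Set ℓ
  IsAdmissible i = ∀ k →
    Σ (ComputableFunction {arity k} (All dom) dom) λ f →
      ∀ {xs} (a : All dom xs) → index (apply-∈ f a) ≈ op k (reduce index a)
    where open Indexing i

  ComputabilityStable : Set (lsuc 0ℓ ⊔ c ⊔ ℓ)
  ComputabilityStable =
    ∃ IsAdmissible ×
    (∀ j j′ → IsAdmissible j → IsAdmissible j′ →
      Σ (ComputableFunction {1} (All (dom j′)) (dom j)) λ h →
        ∀ {x} (p : dom j′ x) → index j′ p ≈ index j (apply-∈ h (p ∷ [])))
    where open Indexing

record Field c ℓ : Set (lsuc (c ⊔ ℓ)) where
  field
    commutativeRing : CommutativeRing c ℓ
  open CommutativeRing commutativeRing public
  open Algebra.Definitions _≈_ using (Invertible)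
  field
    1≉0        : ¬ (1# ≈ 0#)
    invertible : ∀ x → ¬ (x ≈ 0#) → Invertible 1# _*_ x

ℚ-field : Field 0ℓ 0ℓ
ℚ-field = record
  { commutativeRing = ℚ.+-*-commutativeRing
  ; 1≉0             = λ ()
  ; invertible      = λ p p≢0 → let instance _ = ℚ.≢-nonZero p≢0 in
                        ℚ.1/ p , ℚ.*-inverseˡ p , ℚ.*-inverseʳ p
  }

record Extension {k ℓ₁ l ℓ₂} (K : Field k ℓ₁) (L : Field l ℓ₂) : Set (k ⊔ ℓ₁ ⊔ l ⊔ ℓ₂) where
  private
    module K = Field K
    module L = Field L
  field
    ι                  : K.Carrier → L.Carrier
    isRingMonomorphism : RingMorphisms.IsRingMonomorphism K.rawRing L.rawRing ι

  linearCombination : ∀ {n} → (Fin n → K.Carrier) → (Fin n → L.Carrier) → L.Carrier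
  linearCombination r b = sum λ i → ι (r i) L.* b i
    where open Algebra.Definitions.RawMonoid L.+-rawMonoid using (sum)

  record IsBasis {n} (b : Fin n → L.Carrier) : Set (k ⊔ ℓ₁ ⊔ l ⊔ ℓ₂) where
    field
      spanning    : ∀ x → ∃ λ r → x L.≈ linearCombination r b
      independent : ∀ r → linearCombination r b L.≈ L.0# → ∀ i → r i K.≈ K.0#

  -- The degree is the dimension of L over K, so its finiteness is given by a
  -- finite basis (constructively, a finite spanning family would be weaker).
  FiniteDegree : Set (k ⊔ ℓ₁ ⊔ l ⊔ ℓ₂)
  FiniteDegree = ∃ λ n → Σ (Fin n → L.Carrier) IsBasis

⟨_,+,×⟩ : ∀ {c ℓ} → Field c ℓ → Structure c ℓ
⟨ L ,+,×⟩ = record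
  { setoid  = setoid
  ; #ops    = 2
  ; arity   = λ _ → 2
  ; op      = λ { Fin.zero           (x ∷ y ∷ []) → x + y
                ; (Fin.suc Fin.zero) (x ∷ y ∷ []) → x * y }
  ; op-cong = λ { Fin.zero           (p ∷ q ∷ []) → +-cong p q
                ; (Fin.suc Fin.zero) (p ∷ q ∷ []) → *-cong p q }
  }
  where open Field L

{-# OPTIONS --safe #-}
module Submission where

-- Fix a basis b of L over ℚ and code an element of L by the tuple of its rational
-- coordinates, each given by numerators and a denominator in ℕ. Ring operations on
-- coordinates are computable, multiplication through the structure constants
-- b i * b j, and equality is decided by independence of b: this is an admissible
-- indexing. For any admissible indexing j, a coordinate tuple can be turned into a
-- j-index: numerals are obtained by iterated addition, quotients by searching the
-- enumeration of dom j for the solution of a linear equation, and the rest is sums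
-- and products with j-indices of the basis. Given two admissible indexings j and j′,
-- a j′-index is translated into a j-index by searching for a tuple whose j′-index
-- denotes the same element and then computing the j-index of that tuple.

open import Defs
open import Algebra.Bundles using (CommutativeRing)
open import Algebra.Morphism.Structures using (module RingMorphisms)
import Algebra.Properties.CommutativeSemigroup as CommutativeSemigroupProperties
import Algebra.Properties.Group as GroupProperties
import Algebra.Properties.Ring as RingProperties
import Algebra.Properties.Semiring.Mult as Mult
import Algebra.Properties.Semiring.Sum as Sum
open import Data.Fin.Base using (Fin; zero; suc)
open import Data.Fin.Patterns using (0F; 1F)
open import Data.Integer.Base as ℤ using (+_; -[1+_]; _⊖_)
import Data.Integer.Properties as ℤ
open import Data.Integer.Tactic.RingSolver using (solve-∀)
open import Data.Nat.Base as ℕ using (ℕ; zero; suc; _∸_; _≤_; _<_; z≤n; s≤s; s≤s⁻¹)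
import Data.Nat.Properties as ℕ
open import Data.Product.Base using (Σ; ∃; _×_; _,_; proj₁; proj₂; uncurry)
open import Data.Rational.Base as ℚ using (ℚ; 0ℚ; 1ℚ; mkℚ; toℚᵘ; fromℚᵘ)
import Data.Rational.Properties as ℚ
open import Data.Rational.Solver using (module +-*-Solver)
open import Data.Rational.Unnormalised.Base as ℚᵘ using (mkℚᵘ; *≡*) renaming (_≃_ to _≃ᵘ_)
import Data.Rational.Unnormalised.Properties as ℚᵘ
open import Data.Sum.Base using (inj₁; inj₂)
open import Data.Unit.Base using (⊤; tt)
open import Data.Vec.Base using (Vec; []; _∷_; lookup; tabulate)
open import Data.Vec.Properties using (tabulate∘lookup)
open import Data.Vec.Relation.Binary.Pointwise.Inductive using (Pointwise; []; _∷_; tabulate⁺)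
open import Data.Vec.Relation.Unary.All using (All; []; _∷_)
open import Function.Base using (_∘_; id)
open import Function.Bundles using (mk⇔; module Equivalence)
open import Relation.Binary.Definitions using (Decidable)
open import Relation.Binary.PropositionalEquality as ≡ using (_≡_; _≗_)
import Relation.Binary.Reasoning.Setoid as SetoidReasoning
open import Relation.Nullary.Decidable.Core using (yes; no; map′; decidable-stable)
open import Relation.Nullary.Negation.Core using (¬_; contradiction)

-- Closure properties of μ-recursive functions and unbounded search

module Computability where
  open import Data.Nat.Base using (_+_; _*_)
  open ≡ using (refl; sym; trans; cong₂; subst)

  -- Inputs range over an arbitrary type X of admissible arguments, read as numbers
  -- through inp; a partial function is total on a suitable X.
  Computable : ∀ {m} {X : Set} → (X → Vec ℕ m) → (X → ℕ) → Set
  Computable {m} inp f = Σ (Program m) λ p → ∀ x → p ⟨ inp x ⟩⇓ f x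

  module _ {m} {X : Set} {inp : X → Vec ℕ m} where

    argument : ∀ i → Computable inp (λ x → lookup (inp x) i)
    argument i = proj i , λ _ → ⇓-proj i

    constant : ∀ k → Computable inp (λ _ → k)
    constant zero    = zeroᵖ , λ _ → ⇓-zero
    constant (suc k) = comp sucᵖ (proj₁ (constant k) ∷ []) ,
                     λ x → ⇓-comp (proj₂ (constant k) x ∷ []) ⇓-suc

    successor : ∀ {f} → Computable inp f → Computable inp (suc ∘ f)
    successor (p , p⇓) = comp sucᵖ (p ∷ []) , λ x → ⇓-comp (p⇓ x ∷ []) ⇓-suc

    respects : ∀ {f g} → f ≗ g → Computable inp f → Computable inp g
    respects f≗g (p , p⇓) = p , λ x → subst (p ⟨ inp x ⟩⇓_) (f≗g x) (p⇓ x)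

    compose₁ : ∀ {f g} (p : Program 1) → Computable inp f →
               (∀ x → p ⟨ f x ∷ [] ⟩⇓ g x) → Computable inp g
    compose₁ p (q , q⇓) p⇓ = comp p (q ∷ []) , λ x → ⇓-comp (q⇓ x ∷ []) (p⇓ x)

    compose₂ : ∀ {f₁ f₂ g} (p : Program 2) → Computable inp f₁ → Computable inp f₂ →
               (∀ x → p ⟨ f₁ x ∷ f₂ x ∷ [] ⟩⇓ g x) → Computable inp g
    compose₂ p (q , q⇓) (r , r⇓) p⇓ =
      comp p (q ∷ r ∷ []) , λ x → ⇓-comp (q⇓ x ∷ r⇓ x ∷ []) (p⇓ x)

    -- A search puts its candidate in front of the input, so a function of the old input is rerun on
    -- the projections shifted by one.
    weaken : ∀ {Y : Set} {a : Y → ℕ} {f} (h : Y → X) → Computable inp f →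
             Computable (λ y → a y ∷ inp (h y)) (f ∘ h)
    weaken {a = a} h (p , p⇓) = comp p (tabulate (proj ∘ suc)) ,
      λ y → ⇓-comp (subst (Pointwise _ _) (tabulate∘lookup (inp (h y)))
                     (tabulate⁺ (λ i → ⇓-proj {xs = a y ∷ inp (h y)} (suc i))))
                   (p⇓ (h y))

    -- The step program has to be correct only where its second argument is the actual value
    -- `G k x`, with `G` given beforehand. The same form in `recursion₁` lets `Tracked-fromℕ` apply
    -- an operation that is only defined on a domain.
    recursion : (G : ℕ → X → ℕ) → Computable inp (G 0) →
                Computable (λ (k , x) → k ∷ G k x ∷ inp x) (λ (k , x) → G (suc k) x) →
                Computable (λ (k , x) → k ∷ inp x) (uncurry G)
    recursion G (p , p⇓) (q , q⇓) = prec p q , uncurry rec⇓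
      where
      rec⇓ : ∀ k x → prec p q ⟨ k ∷ inp x ⟩⇓ G k x
      rec⇓ zero    x = ⇓-prec-zero (p⇓ x)
      rec⇓ (suc k) x = ⇓-prec-suc (rec⇓ k x) (q⇓ (k , x))

  -- The conclusion has the shape of the premises of `⇓-μ`. The known zero `n` bounds the search: if
  -- `f 0` is positive, `f` is shifted by one and `n` decreases.
  leastZero : ∀ (f : ℕ → ℕ) n → f n ≡ 0 →
              ∃ λ y → f y ≡ 0 × (∀ z → z < y → ∃ λ k → f z ≡ suc k)
  leastZero f n fn≡0 with f 0 in f0
  ... | zero  = 0 , f0 , λ _ ()
  leastZero f zero    fn≡0 | suc k with () ← trans (sym fn≡0) f0
  leastZero f (suc n) fn≡0 | suc k =
    let y , fy≡0 , below = leastZero (f ∘ suc) n fn≡0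
    in suc y , fy≡0 , λ { zero _ → k , f0 ; (suc z) z<y → below z (s≤s⁻¹ z<y) }

  -- Truth is the value 0, the one that `μ` looks for. Conjunctions then become sums, which vanish
  -- only if every summand does.
  record Decider {m ℓ} {X : Set} (inp : X → Vec ℕ m) (P : X → Set ℓ) : Set ℓ where
    field
      {test}          : X → ℕ
      test-computable : Computable inp test
      sound           : ∀ {x} → test x ≡ 0 → P x
      complete        : ∀ {x} → P x → test x ≡ 0

  -- The witness from `total` is a zero of `test` by `complete`, so `μ` terminates; `sound` reads
  -- `P` off the zero that `μ` finds, which may be a smaller one.
  search : ∀ {m ℓ} {X : Set} {inp : X → Vec ℕ m} {P : ℕ × X → Set ℓ} →
           Decider (λ (y , x) → y ∷ inp x) P → (∀ x → ∃ λ y → P (y , x)) →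
           ∃ λ g → Computable inp g × (∀ x → P (g x , x))
  search {inp = inp} P-decider total =
    proj₁ ∘ least , (μ p , μ⇓) , λ x → sound (proj₁ (proj₂ (least x)))
    where
    open Decider P-decider
    p  = proj₁ test-computable
    p⇓ = proj₂ test-computable

    least : ∀ x → ∃ λ y → test (y , x) ≡ 0 × (∀ z → z < y → ∃ λ k → test (z , x) ≡ suc k)
    least x = leastZero (λ y → test (y , x)) (proj₁ (total x)) (complete (proj₂ (total x)))

    μ⇓ : ∀ x → μ p ⟨ inp x ⟩⇓ proj₁ (least x)
    μ⇓ x with y , test≡0 , below ← least x = ⇓-μ
      (λ z z<y → let k , eq = below z z<y in
                 k , subst (p ⟨ z ∷ inp x ⟩⇓_) eq (p⇓ (z , x)))
      (subst (p ⟨ y ∷ inp x ⟩⇓_) test≡0 (p⇓ (y , x)))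

  -- Primitive recursive arithmetic

  Computable₁ : (ℕ → ℕ) → Set
  Computable₁ = Computable {1} (_∷ [])

  Computable₂ : (ℕ → ℕ → ℕ) → Set
  Computable₂ f = Computable {2} (λ (x , y) → x ∷ y ∷ []) (uncurry f)

  module _ {m} {X : Set} {inp : X → Vec ℕ m} where

    lift₁ : ∀ {f g} → Computable₁ f → Computable inp g → Computable inp (f ∘ g)
    lift₁ {g = g} (p , p⇓) q = compose₁ p q (p⇓ ∘ g)

    lift₂ : ∀ {f g h} → Computable₂ f → Computable inp g → Computable inp h →
            Computable inp (λ x → f (g x) (h x))
    lift₂ {g = g} {h} (p , p⇓) q r = compose₂ p q r (λ x → p⇓ (g x , h x))

  recursion₁ : (G : ℕ → ℕ) → Computable (λ k → k ∷ G k ∷ []) (G ∘ suc) → Computable₁ G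
  recursion₁ G (q , q⇓) = prec (proj₁ base) q , rec⇓
    where
    base : Computable {0} {ℕ} (λ _ → []) (λ _ → G 0)
    base = constant (G 0)

    rec⇓ : ∀ k → prec (proj₁ base) q ⟨ k ∷ [] ⟩⇓ G k
    rec⇓ zero    = ⇓-prec-zero (proj₂ base 0)
    rec⇓ (suc k) = ⇓-prec-suc (rec⇓ k) (q⇓ k)

  +-computable : Computable₂ _+_
  +-computable = recursion _+_ (argument 0F) (successor (argument 1F))

  *-computable : Computable₂ _*_
  *-computable = recursion _*_ (constant 0) (lift₂ +-computable (argument (suc 1F)) (argument 1F))

  pred-computable : Computable₁ ℕ.pred
  pred-computable = recursion₁ ℕ.pred (argument 0F)

  ∸-computable : Computable₂ _∸_
  ∸-computable = lift₂ flipped (argument 1F) (argument 0F)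
    where
    -- Primitive recursion runs on the first argument, so the subtrahend is moved there; subtraction
    -- then iterates the predecessor.
    flipped : Computable₂ (λ n m → m ∸ n)
    flipped = recursion (λ n m → m ∸ n) (argument 0F)
      (respects (λ (n , m) → ℕ.pred[m∸n]≡m∸[1+n] m n) (lift₁ pred-computable (argument 1F)))

  -- Integer square roots and a pairing function

  √ : ℕ → ℕ
  √ zero    = 0
  -- The added term is 1 if the square of `suc (√ n)` is at most `suc n`, and 0 otherwise: a case
  -- distinction written as arithmetic.
  √ (suc n) = √ n + (1 ∸ (suc (√ n) * suc (√ n) ∸ suc n))

  √-computable : Computable₁ √
  √-computable = recursion₁ √
    (lift₂ +-computable (argument 1F)
      (lift₂ ∸-computable (constant 1)
        (lift₂ ∸-computable
          (lift₂ *-computable (successor (argument 1F)) (successor (argument 1F)))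
          (successor (argument 0F)))))

  IsSqrt : ℕ → ℕ → Set
  IsSqrt n s = s * s ≤ n × n < suc s * suc s

  √-isSqrt : ∀ n → IsSqrt n (√ n)
  √-isSqrt zero = z≤n , s≤s z≤n
  √-isSqrt (suc n) with s ← √ n | lo , hi ← √-isSqrt n | suc s * suc s ℕ.≤? suc n
  ... | yes le rewrite ℕ.m≤n⇒m∸n≡0 le | ℕ.+-comm s 1 =
    -- Here `hi` is read as `suc n ≤ suc s * suc s`, which lies below the next square.
    le , ℕ.≤-<-trans hi (ℕ.*-mono-< (ℕ.n<1+n (suc s)) (ℕ.n<1+n (suc s)))
  ... | no ¬le rewrite ℕ.m≤n⇒m∸n≡0 (ℕ.m<n⇒0<n∸m (ℕ.≰⇒> ¬le)) | ℕ.+-identityʳ s =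
    ℕ.m≤n⇒m≤1+n lo , ℕ.≰⇒> ¬le

  IsSqrt-unique : ∀ {n s t} → IsSqrt n s → IsSqrt n t → s ≡ t
  IsSqrt-unique (lo , hi) (lo′ , hi′) = ℕ.≤-antisym (bound lo hi′) (bound lo′ hi)
    where
    bound : ∀ {n s t} → s * s ≤ n → n < suc t * suc t → s ≤ t
    bound {n} {s} {t} lo hi = ℕ.≮⇒≥ λ t<s →
      ℕ.<-irrefl refl (ℕ.<-≤-trans hi (ℕ.≤-trans (ℕ.*-mono-≤ t<s t<s) lo))

  -- Not surjective; only the retractions π₁ and π₂ of pair matter.
  pair : ℕ → ℕ → ℕ
  pair a b = a + (a + b) * (a + b)

  π₁ π₂ : ℕ → ℕ
  π₁ n = n ∸ √ n * √ n
  π₂ n = √ n ∸ π₁ n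

  -- Since `a ≤ a + b`, adding `a` to the square of `a + b` does not reach the next square. The root
  -- is therefore the sum and the remainder is `a`.
  √-pair : ∀ a b → √ (pair a b) ≡ a + b
  √-pair a b = IsSqrt-unique (√-isSqrt (pair a b)) (ℕ.m≤n+m _ a , s≤s upper)
    where
    s = a + b
    upper : a + s * s ≤ s + s * suc s
    upper = ℕ.+-mono-≤ (ℕ.m≤m+n a b) (ℕ.*-monoʳ-≤ s (ℕ.n≤1+n s))

  π₁-pair : ∀ a b → π₁ (pair a b) ≡ a
  π₁-pair a b rewrite √-pair a b = ℕ.m+n∸n≡m a ((a + b) * (a + b))

  π₂-pair : ∀ a b → π₂ (pair a b) ≡ b
  π₂-pair a b rewrite π₁-pair a b | √-pair a b = ℕ.m+n∸m≡n a b

  π₁-computable : Computable₁ π₁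
  π₁-computable = lift₂ ∸-computable (argument 0F) (lift₂ *-computable √-computable √-computable)

  π₂-computable : Computable₁ π₂
  π₂-computable = lift₂ ∸-computable √-computable π₁-computable

  pair-computable : Computable₂ pair
  pair-computable = lift₂ +-computable (argument 0F) (lift₂ *-computable +-computable +-computable)

  -- Deciders for equations and finite conjunctions

  module _ {m} {X : Set} {inp : X → Vec ℕ m} where

    -- The test is the distance of the two values: of the two truncated differences at least one is
    -- zero.
    ≡-decider : ∀ {f g} → Computable inp f → Computable inp g → Decider inp (λ x → f x ≡ g x)
    ≡-decider {f} {g} f-comp g-comp = record
      { test-computable = lift₂ +-computable (lift₂ ∸-computable f-comp g-comp)
                                             (lift₂ ∸-computable g-comp f-comp)
      ; sound           = λ {x} eq → ℕ.≤-antisym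
          (ℕ.m∸n≡0⇒m≤n (ℕ.m+n≡0⇒m≡0 (f x ∸ g x) eq))
          (ℕ.m∸n≡0⇒m≤n (ℕ.m+n≡0⇒n≡0 (f x ∸ g x) eq))
      ; complete        = λ {x} eq → cong₂ _+_ (ℕ.m≤n⇒m∸n≡0 (ℕ.≤-reflexive eq))
                                               (ℕ.m≤n⇒m∸n≡0 (ℕ.≤-reflexive (sym eq)))
      }

    ∀-decider : ∀ {ℓ n} {P : Fin n → X → Set ℓ} → (∀ i → Decider inp (P i)) →
                Decider inp (λ x → ∀ i → P i x)
    ∀-decider {n = zero}  P-deciders = record
      { test-computable = constant 0
      ; sound           = λ _ ()
      ; complete        = λ _ → refl
      }
    ∀-decider {n = suc _} P-deciders = record
      { test-computable = lift₂ +-computable P₀.test-computable Ps.test-computable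
      ; sound           = λ {x} eq → λ
          { zero    → P₀.sound (ℕ.m+n≡0⇒m≡0 (P₀.test x) eq)
          ; (suc i) → Ps.sound (ℕ.m+n≡0⇒n≡0 (P₀.test x) eq) i
          }
      ; complete        = λ ps → cong₂ _+_ (P₀.complete (ps zero)) (Ps.complete (ps ∘ suc))
      }
      where
      module P₀ = Decider (P-deciders zero)
      module Ps = Decider (∀-decider (P-deciders ∘ suc))

    Decider-map : ∀ {ℓ ℓ′} {P : X → Set ℓ} {Q : X → Set ℓ′} →
                  (∀ {x} → P x → Q x) → (∀ {x} → Q x → P x) → Decider inp P → Decider inp Q
    Decider-map P⇒Q Q⇒P P-decider = record
      { test-computable = test-computable
      ; sound           = P⇒Q ∘ sound
      ; complete        = complete ∘ Q⇒P
      }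
      where open Decider P-decider

open Computability

-- Rational numbers as fractions of natural numbers

module Fractions where
  open import Data.Nat.Base using (_+_; _*_)
  open ≡ using (refl; sym; trans; cong; cong₂; subst; module ≡-Reasoning)

  module _ {c ℓ} (R : CommutativeRing c ℓ) where
    open CommutativeRing R
      using (_≈_; 1#; setoid; +-group; *-congˡ; *-congʳ; *-identityʳ; *-assoc)
      renaming (_+_ to _⊕_; _*_ to _⊗_)
    open SetoidReasoning setoid
    open GroupProperties +-group using (∙-cancelʳ)

    -- Applied in `ℚ`, where it shows that a fraction determines its value, and in `L`, where it
    -- shows that a quotient found by search is the intended one.
    +-⊗-cancelʳ : ∀ {a u q x y} → a ⊗ u ≈ 1# → x ⊗ a ⊕ q ≈ y ⊗ a ⊕ q → x ≈ y
    +-⊗-cancelʳ {a} {u} {q} {x} {y} au≈1 eq = begin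
      x          ≈⟨ expand x ⟩
      x ⊗ a ⊗ u  ≈⟨ *-congʳ (∙-cancelʳ q (x ⊗ a) (y ⊗ a) eq) ⟩
      y ⊗ a ⊗ u  ≈⟨ expand y ⟨
      y          ∎
      where
      expand : ∀ z → z ≈ z ⊗ a ⊗ u
      expand z = begin
        z            ≈⟨ *-identityʳ z ⟨
        z ⊗ 1#       ≈⟨ *-congˡ au≈1 ⟨
        z ⊗ (a ⊗ u)  ≈⟨ *-assoc z a u ⟨
        z ⊗ a ⊗ u    ∎

  private
    module ℚ-Mult = Mult (CommutativeRing.semiring ℚ.+-*-commutativeRing)

  -- Iterated addition of 1 rather than a fraction over 1: the homomorphism laws are those of
  -- multiples in a semiring, and `fromℕ (suc n)` unfolds to `1ℚ` plus `fromℕ n`, a recursion that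
  -- every admissible indexing can imitate.
  fromℕ : ℕ → ℚ
  fromℕ n = n ℚ-Mult.× 1ℚ

  fromℕ-homo-+ : ∀ m n → fromℕ (m + n) ≡ fromℕ m ℚ.+ fromℕ n
  fromℕ-homo-+ = ℚ-Mult.×-homo-+ 1ℚ

  fromℕ-homo-* : ∀ m n → fromℕ (m * n) ≡ fromℕ m ℚ.* fromℕ n
  fromℕ-homo-* = ℚ-Mult.×1-homo-*

  -- Equality of unnormalised rationals is an equation between integers, so injectivity of `fromℕ`
  -- and the equation behind `fraction` are checked there.
  toℚᵘ-fromℕ : ∀ n → toℚᵘ (fromℕ n) ≃ᵘ mkℚᵘ (+ n) 0
  toℚᵘ-fromℕ zero    = *≡* refl
  toℚᵘ-fromℕ (suc n) = ℚᵘ.≃-trans (ℚ.toℚᵘ-homo-+ 1ℚ (fromℕ n))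
    (ℚᵘ.≃-trans (ℚᵘ.+-congʳ (toℚᵘ 1ℚ) (toℚᵘ-fromℕ n)) (*≡* (ident (+ n))))
    where
    ident : ∀ n → (+ 1 ℤ.* + 1 ℤ.+ n ℤ.* + 1) ℤ.* + 1 ≡ (+ 1 ℤ.+ n) ℤ.* + 1
    ident = solve-∀

  fromℕ-injective : ∀ {m n} → fromℕ m ≡ fromℕ n → m ≡ n
  fromℕ-injective {m} {n} eq with *≡* eq′ ← ℚᵘ.≃-trans (ℚᵘ.≃-sym (toℚᵘ-fromℕ m))
                                       (ℚᵘ.≃-trans (ℚ.toℚᵘ-cong eq) (toℚᵘ-fromℕ n)) =
    ℤ.+-injective (ℤ.*-cancelʳ-≡ (+ m) (+ n) (+ 1) eq′)

  -- r = (p - q) / (1 + d), with both sides moved so that no subtraction occurs.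
  record IsFraction (r : ℚ) (p q d : ℕ) : Set where
    constructor isFraction
    field
      cross-multiplied : r ℚ.* fromℕ (suc d) ℚ.+ fromℕ q ≡ fromℕ p

  open IsFraction

  fraction : ℕ → ℕ → ℕ → ℚ
  fraction p q d = fromℚᵘ (mkℚᵘ (p ⊖ q) d)

  fraction-isFraction : ∀ p q d → IsFraction (fraction p q d) p q d
  fraction-isFraction p q d = isFraction (ℚ.toℚᵘ-injective (begin
    toℚᵘ (r ℚ.* fromℕ (suc d) ℚ.+ fromℕ q)
      ≈⟨ ℚ.toℚᵘ-homo-+ (r ℚ.* fromℕ (suc d)) (fromℕ q) ⟩
    toℚᵘ (r ℚ.* fromℕ (suc d)) ℚᵘ.+ toℚᵘ (fromℕ q)
      ≈⟨ ℚᵘ.+-cong (ℚᵘ.≃-trans (ℚ.toℚᵘ-homo-* r (fromℕ (suc d)))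
           (ℚᵘ.*-cong (ℚ.toℚᵘ-fromℚᵘ (mkℚᵘ (p ⊖ q) d)) (toℚᵘ-fromℕ (suc d)))) (toℚᵘ-fromℕ q) ⟩
    mkℚᵘ (p ⊖ q) d ℚᵘ.* mkℚᵘ (+ suc d) 0 ℚᵘ.+ mkℚᵘ (+ q) 0
      ≈⟨ *≡* cross ⟩
    mkℚᵘ (+ p) 0
      ≈⟨ toℚᵘ-fromℕ p ⟨
    toℚᵘ (fromℕ p) ∎))
    where
    open SetoidReasoning ℚᵘ.≃-setoid
    r = fraction p q d

    ident : ∀ p q d → ((p ℤ.- q) ℤ.* d ℤ.* + 1 ℤ.+ q ℤ.* d) ℤ.* + 1 ≡ p ℤ.* d
    ident = solve-∀

    -- This is the unfolded equation; the factors 1 come from the integers with denominator 1.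
    -- Removing `d * 1` once turns `d * 1 * 1` into `d * 1`, hence the repeated rewrite.
    cross : ((p ⊖ q) ℤ.* + suc d ℤ.* + 1 ℤ.+ + q ℤ.* + suc (d * 1)) ℤ.* + 1 ≡
            + p ℤ.* + suc (d * 1 * 1)
    cross rewrite ℕ.*-identityʳ d | ℕ.*-identityʳ d | sym (ℤ.m-n≡m⊖n p q) =
      ident (+ p) (+ q) (+ suc d)

  -- The inverse is explicit so that `ι` can carry it over to `L`.
  fromℕ-unit : ∀ d → fromℕ (suc d) ℚ.* fraction 1 0 d ≡ 1ℚ
  fromℕ-unit d = begin
    fromℕ (suc d) ℚ.* r        ≡⟨ ℚ.*-comm (fromℕ (suc d)) r ⟩
    r ℚ.* fromℕ (suc d)        ≡⟨ ℚ.+-identityʳ _ ⟨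
    r ℚ.* fromℕ (suc d) ℚ.+ 0ℚ ≡⟨ cross-multiplied (fraction-isFraction 1 0 d) ⟩
    1ℚ                         ∎
    where
    open ≡-Reasoning
    r = fraction 1 0 d

  IsFraction-unique : ∀ {r s p q d} → IsFraction r p q d → IsFraction s p q d → r ≡ s
  IsFraction-unique {d = d} (isFraction r-eq) (isFraction s-eq) =
    +-⊗-cancelʳ ℚ.+-*-commutativeRing {u = fraction 1 0 d} (fromℕ-unit d) (trans r-eq (sym s-eq))

  IsFraction-zero⁺ : ∀ q d → IsFraction 0ℚ q q d
  IsFraction-zero⁺ q d = isFraction
    (trans (cong (ℚ._+ fromℕ q) (ℚ.*-zeroˡ (fromℕ (suc d)))) (ℚ.+-identityˡ (fromℕ q)))

  -- For the value 0 the cross-multiplied sides with `p` and with `q` coincide, so `p` and `q` agree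
  -- in `ℚ` and hence in `ℕ`. Testing a rational for zero thus compares two natural numbers.
  IsFraction-zero⁻ : ∀ {p q d} → IsFraction 0ℚ p q d → p ≡ q
  IsFraction-zero⁻ {p} {q} {d} 0-frac =
    fromℕ-injective (trans (sym (cross-multiplied 0-frac)) (cross-multiplied (IsFraction-zero⁺ q d)))

  asFraction : ∀ r → ∃ λ p → ∃ λ q → ∃ λ d → IsFraction r p q d
  asFraction r@(mkℚ (+ n)    d _) = n , 0 , d ,
    subst (λ r → IsFraction r n 0 d) (ℚ.fromℚᵘ-toℚᵘ r) (fraction-isFraction n 0 d)
  asFraction r@(mkℚ -[1+ n ] d _) = 0 , suc n , d ,
    subst (λ r → IsFraction r 0 (suc n) d) (ℚ.fromℚᵘ-toℚᵘ r) (fraction-isFraction 0 (suc n) d)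

  fromℕ-homo-*+* : ∀ k l m n → fromℕ (k * l + m * n) ≡ fromℕ k ℚ.* fromℕ l ℚ.+ fromℕ m ℚ.* fromℕ n
  fromℕ-homo-*+* k l m n =
    trans (fromℕ-homo-+ (k * l) (m * n)) (cong₂ ℚ._+_ (fromℕ-homo-* k l) (fromℕ-homo-* m n))

  -- suc d * suc d′ reduces to suc (d′ + d * suc d′).
  IsFraction-+ : ∀ {r s p q d p′ q′ d′} → IsFraction r p q d → IsFraction s p′ q′ d′ →
    IsFraction (r ℚ.+ s) (p * suc d′ + p′ * suc d) (q * suc d′ + q′ * suc d) (d′ + d * suc d′)
  IsFraction-+ {r} {s} {p} {q} {d} {p′} {q′} {d′} (isFraction r-eq) (isFraction s-eq) = isFraction (begin
    (r ℚ.+ s) ℚ.* fromℕ (suc d * suc d′) ℚ.+ fromℕ (q * suc d′ + q′ * suc d)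
      ≡⟨ cong₂ (λ D Q → (r ℚ.+ s) ℚ.* D ℚ.+ Q)
           (fromℕ-homo-* (suc d) (suc d′)) (fromℕ-homo-*+* q (suc d′) q′ (suc d)) ⟩
    (r ℚ.+ s) ℚ.* (D ℚ.* D′) ℚ.+ (fromℕ q ℚ.* D′ ℚ.+ fromℕ q′ ℚ.* D)
      ≡⟨ identity r s D D′ (fromℕ q) (fromℕ q′) ⟩
    (r ℚ.* D ℚ.+ fromℕ q) ℚ.* D′ ℚ.+ (s ℚ.* D′ ℚ.+ fromℕ q′) ℚ.* D
      ≡⟨ cong₂ (λ P P′ → P ℚ.* D′ ℚ.+ P′ ℚ.* D) r-eq s-eq ⟩
    fromℕ p ℚ.* D′ ℚ.+ fromℕ p′ ℚ.* D
      ≡⟨ fromℕ-homo-*+* p (suc d′) p′ (suc d) ⟨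
    fromℕ (p * suc d′ + p′ * suc d) ∎)
    where
    open ≡-Reasoning
    D  = fromℕ (suc d)
    D′ = fromℕ (suc d′)

    identity : ∀ r s d d′ q q′ →
               (r ℚ.+ s) ℚ.* (d ℚ.* d′) ℚ.+ (q ℚ.* d′ ℚ.+ q′ ℚ.* d) ≡
               (r ℚ.* d ℚ.+ q) ℚ.* d′ ℚ.+ (s ℚ.* d′ ℚ.+ q′) ℚ.* d
    identity = solve 6 (λ r s d d′ q q′ →
      (r :+ s) :* (d :* d′) :+ (q :* d′ :+ q′ :* d) :=
      (r :* d :+ q) :* d′ :+ (s :* d′ :+ q′) :* d) refl
      where open +-*-Solver

  IsFraction-* : ∀ {r s p q d p′ q′ d′} → IsFraction r p q d → IsFraction s p′ q′ d′ →
    IsFraction (r ℚ.* s) (p * p′ + q * q′) (p * q′ + q * p′) (d′ + d * suc d′)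
  IsFraction-* {r} {s} {p} {q} {d} {p′} {q′} {d′} (isFraction r-eq) (isFraction s-eq) = isFraction (begin
    r ℚ.* s ℚ.* fromℕ (suc d * suc d′) ℚ.+ fromℕ (p * q′ + q * p′)
      ≡⟨ cong₂ (λ D Q → r ℚ.* s ℚ.* D ℚ.+ Q)
           (fromℕ-homo-* (suc d) (suc d′)) (fromℕ-homo-*+* p q′ q p′) ⟩
    r ℚ.* s ℚ.* (D ℚ.* D′) ℚ.+ (fromℕ p ℚ.* fromℕ q′ ℚ.+ fromℕ q ℚ.* fromℕ p′)
      -- Replacing `p` and `p′` by their cross-multiplied expressions leaves a polynomial identity;
      -- the later step with `r-eq` and `s-eq` restores them.
      ≡⟨ cong₂ (λ P P′ → r ℚ.* s ℚ.* (D ℚ.* D′) ℚ.+ (P ℚ.* fromℕ q′ ℚ.+ fromℕ q ℚ.* P′)) r-eq s-eq ⟨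
    r ℚ.* s ℚ.* (D ℚ.* D′) ℚ.+
      ((r ℚ.* D ℚ.+ fromℕ q) ℚ.* fromℕ q′ ℚ.+ fromℕ q ℚ.* (s ℚ.* D′ ℚ.+ fromℕ q′))
      ≡⟨ identity r s D D′ (fromℕ q) (fromℕ q′) ⟩
    (r ℚ.* D ℚ.+ fromℕ q) ℚ.* (s ℚ.* D′ ℚ.+ fromℕ q′) ℚ.+ fromℕ q ℚ.* fromℕ q′
      ≡⟨ cong₂ (λ P P′ → P ℚ.* P′ ℚ.+ fromℕ q ℚ.* fromℕ q′) r-eq s-eq ⟩
    fromℕ p ℚ.* fromℕ p′ ℚ.+ fromℕ q ℚ.* fromℕ q′
      ≡⟨ fromℕ-homo-*+* p p′ q q′ ⟨
    fromℕ (p * p′ + q * q′) ∎)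
    where
    open ≡-Reasoning
    D  = fromℕ (suc d)
    D′ = fromℕ (suc d′)

    identity : ∀ r s d d′ q q′ →
               r ℚ.* s ℚ.* (d ℚ.* d′) ℚ.+ ((r ℚ.* d ℚ.+ q) ℚ.* q′ ℚ.+ q ℚ.* (s ℚ.* d′ ℚ.+ q′)) ≡
               (r ℚ.* d ℚ.+ q) ℚ.* (s ℚ.* d′ ℚ.+ q′) ℚ.+ q ℚ.* q′
    identity = solve 6 (λ r s d d′ q q′ →
      r :* s :* (d :* d′) :+ ((r :* d :+ q) :* q′ :+ q :* (s :* d′ :+ q′)) :=
      (r :* d :+ q) :* (s :* d′ :+ q′) :+ q :* q′) refl
      where open +-*-Solver

  -- The fraction may be unreduced, so no program has to compute a greatest common divisor.
  record ℚ-Computable {m} {X : Set} (inp : X → Vec ℕ m) (r : X → ℚ) : Set where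
    field
      {num⁺ num⁻ den-1} : X → ℕ
      num⁺-computable   : Computable inp num⁺
      num⁻-computable   : Computable inp num⁻
      den-1-computable  : Computable inp den-1
      value-isFraction  : ∀ x → IsFraction (r x) (num⁺ x) (num⁻ x) (den-1 x)

  module _ {m} {X : Set} {inp : X → Vec ℕ m} where

    ℚ-constant : ∀ r → ℚ-Computable inp (λ _ → r)
    ℚ-constant r = let p , q , d , r-frac = asFraction r in record
      { num⁺-computable  = constant p
      ; num⁻-computable  = constant q
      ; den-1-computable = constant d
      ; value-isFraction = λ _ → r-frac
      }

    private
      _+′_ : ∀ {f g} → Computable inp f → Computable inp g → Computable inp (λ x → f x + g x)
      _+′_ = lift₂ +-computable

      _*′_ : ∀ {f g} → Computable inp f → Computable inp g → Computable inp (λ x → f x * g x)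
      _*′_ = lift₂ *-computable

      infixl 6 _+′_
      infixl 7 _*′_

    ℚ-+ : ∀ {r s} → ℚ-Computable inp r → ℚ-Computable inp s →
          ℚ-Computable inp (λ x → r x ℚ.+ s x)
    ℚ-+ r-comp s-comp = record
      { num⁺-computable  = r.num⁺-computable *′ successor s.den-1-computable +′
                           s.num⁺-computable *′ successor r.den-1-computable
      ; num⁻-computable  = r.num⁻-computable *′ successor s.den-1-computable +′
                           s.num⁻-computable *′ successor r.den-1-computable
      ; den-1-computable = s.den-1-computable +′ r.den-1-computable *′ successor s.den-1-computable
      ; value-isFraction = λ x → IsFraction-+ (r.value-isFraction x) (s.value-isFraction x)
      }
      where
      module r = ℚ-Computable r-comp
      module s = ℚ-Computable s-comp

    ℚ-* : ∀ {r s} → ℚ-Computable inp r → ℚ-Computable inp s →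
          ℚ-Computable inp (λ x → r x ℚ.* s x)
    ℚ-* r-comp s-comp = record
      { num⁺-computable  = r.num⁺-computable *′ s.num⁺-computable +′
                           r.num⁻-computable *′ s.num⁻-computable
      ; num⁻-computable  = r.num⁺-computable *′ s.num⁻-computable +′
                           r.num⁻-computable *′ s.num⁺-computable
      ; den-1-computable = s.den-1-computable +′ r.den-1-computable *′ successor s.den-1-computable
      ; value-isFraction = λ x → IsFraction-* (r.value-isFraction x) (s.value-isFraction x)
      }
      where
      module r = ℚ-Computable r-comp
      module s = ℚ-Computable s-comp

  -- Every number decodes to a rational, because the last component is the denominator minus one.
  -- Hence all of `ℕ` can serve as the domain of `standard`; one rational has many codes.
  decodeℚ : ℕ → ℚ
  decodeℚ c = fraction (π₁ c) (π₁ (π₂ c)) (π₂ (π₂ c))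

  decode : ∀ n → ℕ → Fin n → ℚ
  decode (suc n) c zero    = decodeℚ (π₁ c)
  decode (suc n) c (suc i) = decode n (π₂ c) i

  module _ {m} {X : Set} {inp : X → Vec ℕ m} where

    decodeℚ-computable : ∀ {c} → Computable inp c → ℚ-Computable inp (decodeℚ ∘ c)
    decodeℚ-computable {c} c-comp = record
      { num⁺-computable  = lift₁ π₁-computable c-comp
      ; num⁻-computable  = lift₁ π₁-computable (lift₁ π₂-computable c-comp)
      ; den-1-computable = lift₁ π₂-computable (lift₁ π₂-computable c-comp)
      ; value-isFraction = λ x → fraction-isFraction (π₁ (c x)) (π₁ (π₂ (c x))) (π₂ (π₂ (c x)))
      }

    decode-computable : ∀ {n c} → Computable inp c → ∀ i → ℚ-Computable inp (λ x → decode n (c x) i)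
    decode-computable c-comp zero    = decodeℚ-computable (lift₁ π₁-computable c-comp)
    decode-computable c-comp (suc i) = decode-computable (lift₁ π₂-computable c-comp) i

    encodeℚ : ∀ {r} → ℚ-Computable inp r → ∃ λ c → Computable inp c × (∀ x → decodeℚ (c x) ≡ r x)
    encodeℚ {r} r-comp =
      (λ x → pair (num⁺ x) (pair (num⁻ x) (den-1 x))) ,
      lift₂ pair-computable num⁺-computable (lift₂ pair-computable num⁻-computable den-1-computable) ,
      λ x → trans (decodeℚ-pair (num⁺ x) (num⁻ x) (den-1 x))
                  (IsFraction-unique (fraction-isFraction (num⁺ x) (num⁻ x) (den-1 x)) (value-isFraction x))
      where
      open ℚ-Computable r-comp
      decodeℚ-pair : ∀ p q d → decodeℚ (pair p (pair q d)) ≡ fraction p q d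
      decodeℚ-pair p q d = trans
        (cong₂ (λ a c → fraction a (π₁ c) (π₂ c)) (π₁-pair p (pair q d)) (π₂-pair p (pair q d)))
        (cong₂ (fraction p) (π₁-pair q d) (π₂-pair q d))

    encode : ∀ {n} {r : X → Fin n → ℚ} → (∀ i → ℚ-Computable inp (λ x → r x i)) →
             ∃ λ c → Computable inp c × (∀ x i → decode n (c x) i ≡ r x i)
    encode {zero}      r-comp = (λ _ → 0) , constant 0 , λ _ ()
    encode {suc n} {r} r-comp =
      let c₀ , c₀-comp , c₀-eq = encodeℚ (r-comp zero)
          cs , cs-comp , cs-eq = encode (r-comp ∘ suc)
      in (λ x → pair (c₀ x) (cs x)) , lift₂ pair-computable c₀-comp cs-comp , λ x → λ
        { zero    → trans (cong decodeℚ (π₁-pair (c₀ x) (cs x))) (c₀-eq x)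
        ; (suc i) → trans (cong (λ c → decode n c i) (π₂-pair (c₀ x) (cs x))) (cs-eq x i)
        }

    ≡0-decider : ∀ {r} → ℚ-Computable inp r → Decider inp (λ x → r x ≡ 0ℚ)
    ≡0-decider {r} r-comp = Decider-map
      (λ {x} eq → IsFraction-unique (value-isFraction x)
        (subst (λ p → IsFraction 0ℚ p (num⁻ x) (den-1 x)) (sym eq) (IsFraction-zero⁺ (num⁻ x) (den-1 x))))
      (λ {x} eq → IsFraction-zero⁻
        (subst (λ r → IsFraction r (num⁺ x) (num⁻ x) (den-1 x)) eq (value-isFraction x)))
      (≡-decider num⁺-computable num⁻-computable)
      where open ℚ-Computable r-comp

open Fractions
open IsFraction

-- Coordinates with respect to a basis of the extension

module _ {c ℓ} (L : Field c ℓ) (L/ℚ : Extension ℚ-field L) where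
  open Field L hiding (zero)
  open Extension L/ℚ
  open RingMorphisms.IsRingMonomorphism isRingMonomorphism
    using (⟦⟧-cong; +-homo; *-homo; 0#-homo; 1#-homo)
  open Sum semiring
    using (sum; sum-cong-≋; sum-replicate-zero; ∑-distrib-+; *-distribˡ-sum; *-distribʳ-sum)
  open CommutativeSemigroupProperties *-commutativeSemigroup using (x∙yz≈y∙xz)
  open SetoidReasoning setoid

  module Basis {n} {b : Fin n → Carrier} (b-isBasis : IsBasis b) where
    open IsBasis b-isBasis

    private
      terms : (Fin n → ℚ) → Fin n → Carrier
      terms r i = ι (r i) * b i

    record Representable {m} {X : Set} (inp : X → Vec ℕ m) (F : X → Carrier) : Set ℓ where
      field
        {coordinates}          : X → Fin n → ℚ
        coordinates-computable : ∀ i → ℚ-Computable inp (λ x → coordinates x i)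
        represents             : ∀ x → F x ≈ linearCombination (coordinates x) b

    module _ {m} {X : Set} {inp : X → Vec ℕ m} where

      Representable-resp-≈ : ∀ {F G} → (∀ x → G x ≈ F x) → Representable inp F → Representable inp G
      Representable-resp-≈ G≈F F-rep = record
        { coordinates-computable = coordinates-computable
        ; represents             = λ x → trans (G≈F x) (represents x)
        }
        where open Representable F-rep

      Representable-constant : ∀ a → Representable inp (λ _ → a)
      Representable-constant a = let r , a≈ = spanning a in record
        { coordinates-computable = λ i → ℚ-constant (r i)
        ; represents             = λ _ → a≈
        }

      Representable-+ : ∀ {F G} → Representable inp F → Representable inp G →
                        Representable inp (λ x → F x + G x)
      Representable-+ {F} {G} F-rep G-rep = record
        { coordinates-computable = λ i → ℚ-+ (F.coordinates-computable i) (G.coordinates-computable i)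
        ; represents             = λ x → let r = F.coordinates x; s = G.coordinates x in begin
            F x + G x                                     ≈⟨ +-cong (F.represents x) (G.represents x) ⟩
            linearCombination r b + linearCombination s b ≈⟨ ∑-distrib-+ (terms r) (terms s) ⟨
            sum (λ i → ι (r i) * b i + ι (s i) * b i)     ≈⟨ sum-cong-≋ {n} (λ i → trans
                                                               (*-congʳ (+-homo (r i) (s i))) (distribʳ (b i) _ _)) ⟨
            linearCombination (λ i → r i ℚ.+ s i) b       ∎
        }
        where
        module F = Representable F-rep
        module G = Representable G-rep

      Representable-scale : ∀ {q F} → ℚ-Computable inp q → Representable inp F →
                            Representable inp (λ x → ι (q x) * F x)
      Representable-scale {q} {F} q-comp F-rep = record
        { coordinates-computable = λ i → ℚ-* q-comp (coordinates-computable i)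
        ; represents             = λ x → let r = coordinates x in begin
            ι (q x) * F x                             ≈⟨ *-congˡ (represents x) ⟩
            ι (q x) * linearCombination r b           ≈⟨ *-distribˡ-sum (ι (q x)) (terms r) ⟩
            sum (λ i → ι (q x) * (ι (r i) * b i))     ≈⟨ sum-cong-≋ {n} (λ i → trans
                                                           (*-congʳ (*-homo (q x) (r i))) (*-assoc _ _ (b i))) ⟨
            linearCombination (λ i → q x ℚ.* r i) b   ∎
        }
        where open Representable F-rep

      Representable-sum : ∀ {k} {F : Fin k → X → Carrier} → (∀ i → Representable inp (F i)) →
                          Representable inp (λ x → sum (λ i → F i x))
      Representable-sum {zero}  F-rep = Representable-constant 0#
      Representable-sum {suc k} F-rep = Representable-+ (F-rep zero) (Representable-sum (F-rep ∘ suc))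

      -- Multiplication by `a` is linear over `ℚ`, so it is determined by the products `a * b i`,
      -- whose coordinates enter the programs as constants.
      Representable-constant-* : ∀ a {F} → Representable inp F → Representable inp (λ x → a * F x)
      Representable-constant-* a {F} F-rep = Representable-resp-≈
        (λ x → let r = coordinates x in begin
          a * F x                           ≈⟨ *-congˡ (represents x) ⟩
          a * linearCombination r b         ≈⟨ *-distribˡ-sum a (terms r) ⟩
          sum (λ i → a * (ι (r i) * b i))   ≈⟨ sum-cong-≋ {n} (λ i → x∙yz≈y∙xz a (ι (r i)) (b i)) ⟩
          sum (λ i → ι (r i) * (a * b i))   ∎)
        (Representable-sum (λ i →
          Representable-scale (coordinates-computable i) (Representable-constant (a * b i))))
        where open Representable F-rep

      -- Expanding only the left factor leaves multiplications by the fixed elements `b i`; the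
      -- structure constants appear inside `Representable-constant-*`.
      Representable-* : ∀ {F G} → Representable inp F → Representable inp G →
                        Representable inp (λ x → F x * G x)
      Representable-* {F} {G} F-rep G-rep = Representable-resp-≈
        (λ x → let r = coordinates x in begin
          F x * G x                           ≈⟨ *-congʳ (represents x) ⟩
          linearCombination r b * G x         ≈⟨ *-distribʳ-sum (G x) (terms r) ⟩
          sum (λ i → ι (r i) * b i * G x)     ≈⟨ sum-cong-≋ {n} (λ i → *-assoc (ι (r i)) (b i) (G x)) ⟩
          sum (λ i → ι (r i) * (b i * G x))   ∎)
        (Representable-sum (λ i →
          Representable-scale (coordinates-computable i) (Representable-constant-* (b i) G-rep)))
        where open Representable F-rep

      -- By `independent`, an element is zero only if all its coordinates are, so finitely many zero
      -- tests in `ℚ` suffice.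
      ≈0-decider : ∀ {F} → Representable inp F → Decider inp (λ x → F x ≈ 0#)
      ≈0-decider {F} F-rep = Decider-map
        (λ {x} r≡0 → let r = coordinates x in begin
          F x                          ≈⟨ represents x ⟩
          linearCombination r b        ≈⟨ sum-cong-≋ {n} (λ i → trans (*-congʳ (trans (⟦⟧-cong (r≡0 i)) 0#-homo)) (zeroˡ (b i))) ⟩
          sum {n} (λ _ → 0#)           ≈⟨ sum-replicate-zero n ⟩
          0#                           ∎)
        (λ {x} F≈0 → independent (coordinates x) (trans (sym (represents x)) F≈0))
        (∀-decider (λ i → ≡0-decider (coordinates-computable i)))
        where open Representable F-rep

      ≈-decider : ∀ {F G} → Representable inp F → Representable inp G →
                  Decider inp (λ x → F x ≈ G x)
      ≈-decider {F} {G} F-rep G-rep = Decider-map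
        (λ {x} eq → x∙y⁻¹≈ε⇒x≈y (F x) (G x) (trans (+-congˡ (sym (-1*x≈-x (G x)))) eq))
        (λ {x} eq → trans (+-congˡ (-1*x≈-x (G x))) (x≈y⇒x∙y⁻¹≈ε eq))
        -- Subtraction is expressed through multiplication by the constant `- 1#`.
        (≈0-decider (Representable-+ F-rep (Representable-constant-* (- 1#) G-rep)))
        where
        open GroupProperties +-group using (x∙y⁻¹≈ε⇒x≈y; x≈y⇒x∙y⁻¹≈ε)
        open RingProperties ring using (-1*x≈-x)

    -- A decider for constants on the empty input already decides equality in `L`. This later
    -- removes the double negation left by the specification of `eq`.
    _≈?_ : Decidable _≈_
    x ≈? y = map′ sound complete (test tt ℕ.≟ 0)
      where
      x≈y-decider : Decider {0} {X = ⊤} (λ _ → []) (λ _ → x ≈ y)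
      x≈y-decider = ≈-decider (Representable-constant x) (Representable-constant y)

      open Decider x≈y-decider

    value : ℕ → Carrier
    value k = linearCombination (decode n k) b

    module _ {m} {X : Set} {inp : X → Vec ℕ m} where

      value-representable : ∀ {k} → Computable inp k → Representable inp (value ∘ k)
      value-representable k-comp = record
        { coordinates-computable = decode-computable k-comp
        ; represents             = λ _ → refl
        }

      codes : ∀ {F} → Representable inp F → ∃ λ k → Computable inp k × (∀ x → value (k x) ≈ F x)
      codes {F} F-rep = let k , k-comp , k-eq = encode coordinates-computable in
        k , k-comp , λ x → begin
          value (k x)                           ≈⟨ sum-cong-≋ {n} (λ i → *-congʳ (⟦⟧-cong (k-eq x i))) ⟩
          linearCombination (coordinates x) b   ≈⟨ represents x ⟨
          F x                                   ∎
        where open Representable F-rep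

    -- The indexing by coordinate tuples

    standard : Indexing setoid
    standard = record
      { dom            = λ _ → ⊤
      ; index          = λ {k} _ → value k
      ; irrelevant     = λ _ _ → refl
      ; dom-enumerable = inj₂ (record { program = proj 0F ; defined = λ { {x ∷ []} _ → x , ⇓-proj 0F , _ } } ,
                               λ y → mk⇔ (λ _ → y , ≡.refl) _)
      -- A single element is encoded as a constant family over a one-point input type.
      ; surjective     = λ a → let k , _ , k-eq = codes {inp = λ (_ : ⊤) → []} (Representable-constant a)
                               in k tt , tt , k-eq tt
      -- The test vanishes on equality whereas `eq` must return 1 there; `1 ∸_` reverses the
      -- convention and confines the values to 0 and 1.
      ; eq             = record
        { program = proj₁ eq-computable
        ; defined = λ { {x ∷ y ∷ []} _ → 1 ∸ test (x , y) , proj₂ eq-computable (x , y) , 1∸∈ (test (x , y)) }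
        }
      ; eq-1           = λ {x} {y} _ _ x≈y → ≡.cong (1 ∸_) (complete x≈y)
      ; eq-0           = λ {x} {y} _ _ x≉y → 1∸≡0 (test (x , y)) (x≉y ∘ sound)
      }
      where
      ≈-codes : Decider {2} (λ (x , y) → x ∷ y ∷ []) (λ (x , y) → value x ≈ value y)
      ≈-codes = ≈-decider (value-representable (argument 0F)) (value-representable (argument 1F))

      open Decider ≈-codes

      eq-computable : Computable₂ (λ x y → 1 ∸ test (x , y))
      eq-computable = lift₂ ∸-computable (constant 1) test-computable

      1∸∈ : ∀ k → ｛0,1｝ (1 ∸ k)
      1∸∈ zero    = inj₂ ≡.refl
      1∸∈ (suc k) = inj₁ (ℕ.0∸n≡0 k)

      1∸≡0 : ∀ k → ¬ k ≡ 0 → 1 ∸ k ≡ 0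
      1∸≡0 zero    k≢0 = contradiction ≡.refl k≢0
      1∸≡0 (suc k) _   = ℕ.0∸n≡0 k

    standard-isAdmissible : IsAdmissible ⟨ L ,+,×⟩ standard
    standard-isAdmissible k = record
      { program = proj₁ (proj₁ (proj₂ (op-codes k)))
      ; defined = λ {xs} _ → _ , proj₂ (proj₁ (proj₂ (op-codes k))) xs , tt
      } , λ { {x ∷ y ∷ []} (_ ∷ _ ∷ []) → proj₂ (proj₂ (op-codes k)) (x ∷ y ∷ []) }
      where
      op = Structure.op ⟨ L ,+,×⟩

      op′ : ∀ (k : Fin 2) → Vec ℕ 2 → Carrier
      op′ k (x ∷ y ∷ []) = op k (value x ∷ value y ∷ [])

      op-representable : ∀ k → Representable id (op′ k)
      op-representable zero       = Representable-resp-≈ (λ { (x ∷ y ∷ []) → refl })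
        (Representable-+ (value-representable (argument 0F)) (value-representable (argument 1F)))
      op-representable (suc zero) = Representable-resp-≈ (λ { (x ∷ y ∷ []) → refl })
        (Representable-* (value-representable (argument 0F)) (value-representable (argument 1F)))

      op-codes : ∀ k → ∃ λ f → Computable id f × (∀ xs → value (f xs) ≈ op′ k xs)
      op-codes k = codes (op-representable k)

    -- Computation inside an arbitrary admissible indexing

    module Admissible (j : Indexing setoid) (j-isAdmissible : IsAdmissible ⟨ L ,+,×⟩ j) where
      open Indexing j

      -- The counterpart of `Representable` for an unknown indexing: in place of coordinates, a
      -- computable choice of `j`-indices.
      record Tracked {m} {X : Set} (inp : X → Vec ℕ m) (F : X → Carrier) : Set ℓ where
        field
          {code}          : X → ℕ
          code-computable : Computable inp code
          code∈dom        : ∀ x → dom (code x)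
          index-code      : ∀ x → index (code∈dom x) ≈ F x

      module _ {m} {X : Set} {inp : X → Vec ℕ m} where

        Tracked-resp-≈ : ∀ {F G} → (∀ x → F x ≈ G x) → Tracked inp F → Tracked inp G
        Tracked-resp-≈ F≈G F-tracked = record
          { code-computable = code-computable
          ; code∈dom        = code∈dom
          ; index-code      = λ x → trans (index-code x) (F≈G x)
          }
          where open Tracked F-tracked

        Tracked-constant : ∀ a → Tracked inp (λ _ → a)
        Tracked-constant a = let k , k∈dom , k-index = surjective a in record
          { code-computable = constant k
          ; code∈dom        = λ _ → k∈dom
          ; index-code      = λ _ → k-index
          }

        Tracked-weaken : ∀ {F} → Tracked inp F → Tracked (λ (y , x) → y ∷ inp x) (F ∘ proj₂)
        Tracked-weaken F-tracked = record
          { code-computable = weaken proj₂ code-computable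
          ; code∈dom        = code∈dom ∘ proj₂
          ; index-code      = index-code ∘ proj₂
          }
          where open Tracked F-tracked

        Tracked-compose : ∀ {F : ℕ → Carrier} {f} → Tracked {1} (_∷ []) F → Computable inp f →
                          Tracked inp (F ∘ f)
        Tracked-compose {f = f} F-tracked f-comp = record
          { code-computable = lift₁ code-computable f-comp
          ; code∈dom        = code∈dom ∘ f
          ; index-code      = index-code ∘ f
          }
          where open Tracked F-tracked

        Tracked-op : ∀ k {F G} → Tracked inp F → Tracked inp G →
                     Tracked inp (λ x → Structure.op ⟨ L ,+,×⟩ k (F x ∷ G x ∷ []))
        Tracked-op k F-tracked G-tracked = let f , f-op = j-isAdmissible k in record
          { code-computable = compose₂ (ComputableFunction.program f) F.code-computable G.code-computable
              (λ x → proj₁ (proj₂ (ComputableFunction.defined f (codes∈dom x))))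
          ; code∈dom        = λ x → apply-∈ f (codes∈dom x)
          ; index-code      = λ x → trans (f-op (codes∈dom x))
              (Structure.op-cong ⟨ L ,+,×⟩ k (F.index-code x ∷ G.index-code x ∷ []))
          }
          where
          module F = Tracked F-tracked
          module G = Tracked G-tracked
          codes∈dom : ∀ x → All dom (F.code x ∷ G.code x ∷ [])
          codes∈dom x = F.code∈dom x ∷ G.code∈dom x ∷ []

        Tracked-+ : ∀ {F G} → Tracked inp F → Tracked inp G → Tracked inp (λ x → F x + G x)
        Tracked-+ = Tracked-op 0F

        Tracked-* : ∀ {F G} → Tracked inp F → Tracked inp G → Tracked inp (λ x → F x * G x)
        Tracked-* = Tracked-op 1F

        Tracked-sum : ∀ {k} {F : Fin k → X → Carrier} → (∀ i → Tracked inp (F i)) →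
                      Tracked inp (λ x → sum (λ i → F i x))
        Tracked-sum {zero}  F-tracked = Tracked-constant 0#
        Tracked-sum {suc k} F-tracked = Tracked-+ (F-tracked zero) (Tracked-sum (F-tracked ∘ suc))

        Tracked-≈-decider : ∀ {F G} → Tracked inp F → Tracked inp G → Decider inp (λ x → F x ≈ G x)
        Tracked-≈-decider {F} {G} F-tracked G-tracked = record
          { test-computable = lift₂ ∸-computable (constant 1)
              (compose₂ (ComputableFunction.program eq) F.code-computable G.code-computable
                (λ x → proj₁ (proj₂ (ComputableFunction.defined eq (codes∈dom x)))))
          ; sound           = λ {x} → test-sound x
          ; complete        = λ {x} F≈G → ≡.cong (1 ∸_) (eq-1 _ _
              (trans (F.index-code x) (trans F≈G (sym (G.index-code x)))))
          }
          where
          module F = Tracked F-tracked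
          module G = Tracked G-tracked
          codes∈dom : ∀ x → All dom (F.code x ∷ G.code x ∷ [])
          codes∈dom x = F.code∈dom x ∷ G.code∈dom x ∷ []

          -- eq is only specified up to double negation when it returns 1.
          test-sound : ∀ x → 1 ∸ apply eq (codes∈dom x) ≡ 0 → F x ≈ G x
          test-sound x test≡0 = decidable-stable (F x ≈? G x) λ F≉G → contradiction
            (≡.trans (≡.cong (1 ∸_) (≡.sym (eq-0 (F.code∈dom x) (G.code∈dom x)
              (λ eq → F≉G (trans (sym (F.index-code x)) (trans eq (G.index-code x))))))) test≡0)
            λ ()

      Tracked-fromℕ : Tracked (_∷ []) (ι ∘ fromℕ)
      Tracked-fromℕ = record
        { code-computable = recursion₁ (proj₁ ∘ numeral)
            (compose₂ (ComputableFunction.program add) (constant one) (argument 1F)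
              (λ k → proj₁ (proj₂ (ComputableFunction.defined add (one∈dom ∷ proj₁ (proj₂ (numeral k)) ∷ [])))))
        ; code∈dom        = proj₁ ∘ proj₂ ∘ numeral
        ; index-code      = proj₂ ∘ proj₂ ∘ numeral
        }
        where
        add       = proj₁ (j-isAdmissible 0F)
        one       = proj₁ (surjective (ι 1ℚ))
        one∈dom   = proj₁ (proj₂ (surjective (ι 1ℚ)))
        one-index = proj₂ (proj₂ (surjective (ι 1ℚ)))

        -- Code, membership and value are built together, since `add` can be applied only to a
        -- previous code known to lie in `dom`.
        numeral : ∀ k → ∃ λ x → Σ (dom x) λ p → index p ≈ ι (fromℕ k)
        numeral zero    = surjective (ι 0ℚ)
        numeral (suc k) = let x , p , x-index = numeral k in
          apply add (one∈dom ∷ p ∷ []) , apply-∈ add (one∈dom ∷ p ∷ []) , (begin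
            index (apply-∈ add (one∈dom ∷ p ∷ [])) ≈⟨ proj₂ (j-isAdmissible 0F) (one∈dom ∷ p ∷ []) ⟩
            index one∈dom + index p                ≈⟨ +-cong one-index x-index ⟩
            ι 1ℚ + ι (fromℕ k)                     ≈⟨ +-homo 1ℚ (fromℕ k) ⟨
            ι (fromℕ (suc k))                      ∎)

      -- `μ` tries all natural numbers, but `eq` need not be defined outside `dom`. Searches
      -- therefore run over the arguments of an enumeration of `dom`.
      enumeration : ∃ λ (e : ℕ → Carrier) → Tracked (_∷ []) e × (∀ a → ∃ λ y → e y ≈ a)
      enumeration with dom-enumerable
      -- The domain is inhabited because `0#` has an index.
      ... | inj₁ empty = contradiction (proj₁ (proj₂ (surjective 0#))) (empty _)
      ... | inj₂ (f , dom⇔image) =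
        (λ y → index (f∈dom y)) ,
        record
          { code-computable = ComputableFunction.program f ,
                              λ y → proj₁ (proj₂ (ComputableFunction.defined f {y ∷ []} _))
          ; code∈dom        = f∈dom
          ; index-code      = λ _ → refl
          } ,
        λ a → let x , x∈dom , x-index = surjective a
                  y , fy≡x            = Equivalence.to (dom⇔image x) x∈dom
              in y , trans (index-≡ fy≡x (f∈dom y) x∈dom) x-index
        where
        f∈dom : ∀ y → dom (apply f {y ∷ []} _)
        f∈dom y = Equivalence.from (dom⇔image _) (y , ≡.refl)

        index-≡ : ∀ {x y} → x ≡ y → (p : dom x) (q : dom y) → index p ≈ index q
        index-≡ ≡.refl = irrelevant

      module _ {m} {X : Set} {inp : X → Vec ℕ m} where

        -- The structure has no division: ι (r x) is found by searching dom for a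
        -- solution z of z * ι (1 + d) + ι q ≈ ι p.
        Tracked-ι : ∀ {r} → ℚ-Computable inp r → Tracked inp (ι ∘ r)
        Tracked-ι {r} r-comp = Tracked-resp-≈ (λ x → unique x (proj₂ (proj₂ found) x))
          (Tracked-compose e-tracked (proj₁ (proj₂ found)))
          where
          open ℚ-Computable r-comp
          e           = proj₁ enumeration
          e-tracked   = proj₁ (proj₂ enumeration)
          e-surjective = proj₂ (proj₂ enumeration)

          den : X → Carrier
          den x = ι (fromℕ (suc (den-1 x)))

          Solves : Carrier → X → Set ℓ
          Solves z x = z * den x + ι (fromℕ (num⁻ x)) ≈ ι (fromℕ (num⁺ x))

          ιr-solves : ∀ x → Solves (ι (r x)) x
          ιr-solves x = begin
            ι (r x) * den x + ι (fromℕ (num⁻ x))                    ≈⟨ +-congʳ (*-homo (r x) _) ⟨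
            ι (r x ℚ.* fromℕ (suc (den-1 x))) + ι (fromℕ (num⁻ x))  ≈⟨ +-homo _ _ ⟨
            ι (r x ℚ.* fromℕ (suc (den-1 x)) ℚ.+ fromℕ (num⁻ x))    ≈⟨ ⟦⟧-cong (cross-multiplied (value-isFraction x)) ⟩
            ι (fromℕ (num⁺ x))                                      ∎

          -- Whichever solution the search returns is correct: `den x` is the image of a unit of
          -- `ℚ`, so it can be cancelled.
          unique : ∀ {z} x → Solves z x → z ≈ ι (r x)
          unique x z-solves = +-⊗-cancelʳ commutativeRing den-unit (trans z-solves (sym (ιr-solves x)))
            where
            den-unit : den x * ι (fraction 1 0 (den-1 x)) ≈ 1#
            den-unit = begin
              den x * ι (fraction 1 0 (den-1 x))                        ≈⟨ *-homo _ _ ⟨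
              ι (fromℕ (suc (den-1 x)) ℚ.* fraction 1 0 (den-1 x))  ≈⟨ ⟦⟧-cong (fromℕ-unit (den-1 x)) ⟩
              ι 1ℚ                                                      ≈⟨ 1#-homo ⟩
              1#                                                        ∎

          solves-decider : Decider (λ (y , x) → y ∷ inp x) (λ (y , x) → Solves (e y) x)
          solves-decider = Tracked-≈-decider
            (Tracked-+ (Tracked-* (Tracked-compose e-tracked (argument 0F))
                                  (Tracked-weaken (Tracked-compose Tracked-fromℕ (successor den-1-computable))))
                       (Tracked-weaken (Tracked-compose Tracked-fromℕ num⁻-computable)))
            (Tracked-weaken (Tracked-compose Tracked-fromℕ num⁺-computable))

          found : ∃ λ y → Computable inp y × (∀ x → Solves (e (y x)) x)
          found = search solves-decider λ x → let y , ey≈ιr = e-surjective (ι (r x)) in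
            y , trans (+-congʳ (*-congʳ ey≈ιr)) (ιr-solves x)

        -- The linear combination is evaluated with the operations of `j`; indices of the finitely
        -- many `b i` are constants of the program.
        Representable⇒Tracked : ∀ {F} → Representable inp F → Tracked inp F
        Representable⇒Tracked F-rep = Tracked-resp-≈ (λ x → sym (represents x))
          (Tracked-sum (λ i → Tracked-* (Tracked-ι (coordinates-computable i)) (Tracked-constant (b i))))
          where open Representable F-rep

    -- Translation between admissible indexings

    translation : ∀ j j′ → IsAdmissible ⟨ L ,+,×⟩ j → IsAdmissible ⟨ L ,+,×⟩ j′ →
      let open Indexing in
      Σ (ComputableFunction {1} (All (dom j′)) (dom j)) λ h →
        ∀ {x} (p : dom j′ x) → index j′ p ≈ index j (apply-∈ h (p ∷ []))
    translation j j′ j-isAdmissible j′-isAdmissible = record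
      { program = proj₁ code-computable
      ; defined = λ { (p ∷ []) → code (_ , p) , proj₂ code-computable (_ , p) , code∈dom (_ , p) }
      } , λ p → sym (index-code (_ , p))
      where
      module J  = Admissible j  j-isAdmissible
      module J′ = Admissible j′ j′-isAdmissible
      open Indexing j′

      -- An input is a number together with its membership in the domain of `j′`, so totality is
      -- claimed only there; the program reads the number alone.
      Point : Set
      Point = ∃ dom

      inp : Point → Vec ℕ 1
      inp (x , _) = x ∷ []

      point : Point → Carrier
      point (_ , p) = index p

      point-tracked : J′.Tracked inp point
      point-tracked = record
        { code-computable = argument 0F
        ; code∈dom        = proj₂
        ; index-code      = λ _ → refl
        }

      found : ∃ λ k → Computable inp k × (∀ x → value (k x) ≈ point x)
      -- Candidates are the codes of coordinate tuples. Each is evaluated in `j′` and compared with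
      -- the input by the `eq` of `j′`; surjectivity of `standard` makes the search succeed.
      found = search
        (J′.Tracked-≈-decider (J′.Representable⇒Tracked (value-representable (argument 0F)))
                              (J′.Tracked-weaken point-tracked))
        λ x → let k , _ , k-eq = Indexing.surjective standard (point x) in k , k-eq

      -- The tuple found has computable coordinates, so the same evaluation carried out in `j`
      -- yields an index of the same element.
      open J.Tracked (J.Tracked-resp-≈ (proj₂ (proj₂ found))
        (J.Representable⇒Tracked (value-representable (proj₁ (proj₂ found)))))

proposition11 : ∀ {c ℓ} (L : Field c ℓ) (L/ℚ : Extension ℚ-field L) → Extension.FiniteDegree L/ℚ → ComputabilityStable ⟨ L ,+,×⟩
proposition11 L L/ℚ (n , b , b-isBasis) = (standard , standard-isAdmissible) , translation
  where open Basis L L/ℚ b-isBasis
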